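{- The system MaxSAT resolution $+$ cost-SR is sound: if from a MaxSAT instance with satisfiable hard clauses $H_0=\{C_1\lor b_1,\dots,C_m\lor b_m\}$ and soft clauses $S_0=\{\lnot b_1,\dots,\lnot b_m\}$ there is a MaxSAT resolution $+$ cost-SR derivation $(H_0,S_0),\dots,(H_t,S_t)$ such that $S_t$ contains the empty clause $\bot$ with multiplicity $k$, then every assignment satisfying $H_0$ falsifies at least $k$ clauses of $S_0$; equivalently $\mathrm{cost}(H_0)\ge k$.
   Context: $b_1,\dots,b_m$ are distinct blocking variables not occurring in $C_1,\dots,C_m$; $\mathrm{cost}(\alpha)=\sum_i\alpha(b_i)$, $\mathrm{cost}(H)=\min\{\mathrm{cost}(\alpha):\alpha\text{ total},\alpha\models H\}$. Notation: substitutions map variables to $0,1$ or literals ($\sigma(\lnot x)=\lnot\sigma(x)$); $(\sigma\circ\tau)(x)=\sigma(\tau(x))$; $C{\upharpoonright}_\sigma$ and $\Gamma{\upharpoonright}_\sigma$ denote restriction (clauses set to $1$ removed); $\lnot C$ is the partial assignment falsifying all literals of $C$; $\Gamma\vdash_1 C$ means unit propagation on $\Gamma{\upharpoonright}_{\lnot C}$ derives $\bot$, and $\Gamma\vdash_1\Delta$ means this for all $D\in\Delta$. $C$ is cost-SR w.r.t. $\Gamma$ if some substitution $\sigma$ satisfies (1) $\Gamma{\upharpoonright}_{\lnot C}\vdash_1(\Gamma\cup\{C\}){\upharpoonright}_\sigma$ and (2) $\mathrm{cost}(\tau\circ\sigma)\le\mathrm{cost}(\tau)$ for all total $\tau\supseteq\lnot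 C$. A MaxSAT resolution $+$ cost-SR derivation is a sequence of pairs of multisets $(H_i,S_i)$ where each step is one of: (a) $S_i=S_{i-1}$, $H_i=H_{i-1}\cup\{C\}$ with $C$ obtained by resolution (or weakening) from $H_{i-1}$; (a') $S_i=S_{i-1}$, $H_i=H_{i-1}\cup\{C\}$ with $C$ cost-SR w.r.t. $H_{i-1}$; (b) $S_i=S_{i-1}\cup\{C\}$ for some $C\in H_{i-1}$, $H_i=H_{i-1}$; (c) $S_i=S_{i-1}\setminus\{C\}\cup\{C\lor x,C\lor\lnot x\}$ for $C\in S_{i-1}$, $H_i=H_{i-1}$; (d) $S_i=S_{i-1}\setminus\{C\lor x,C\lor\lnot x\}\cup\{C\}$ for $\{C\lor x,C\lor\lnot x\}\subseteq S_{i-1}$, $H_i=H_{i-1}$. -}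

module Defs where

open import Data.Bool.Base using (Bool; true; false; not; if_then_else_)
open import Data.Bool.Properties using () renaming (_≟_ to _≟ᵇ_)
open import Data.Fin.Base using (Fin)
open import Data.List.Base using (List; []; _∷_; [_]; _++_; length; filter; filterᵇ; mapMaybe; null; tabulate)
open import Data.List.Membership.Propositional using (_∈_)
open import Data.List.Relation.Binary.BagAndSetEquality using ([_]-Equality; set)
open import Data.List.Relation.Binary.Subset.Propositional using (_⊆_)
open import Data.List.Relation.Unary.All using (All)
open import Data.List.Relation.Unary.Any using (Any; any?)
open import Data.Maybe.Base using (Maybe; just; nothing)
open import Data.Nat.Base using (ℕ; _≤_)
open import Data.Nat.ListAction using (sum)
open import Data.Nat.Properties using (_≟_)
open import Data.Product.Base using (_×_; _,_; ∃-syntax)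
open import Data.Sum.Base using (_⊎_)
open import Relation.Binary.Bundles using (Setoid)
open import Relation.Binary.Construct.Closure.ReflexiveTransitive using (Star)
open import Relation.Binary.Definitions using (DecidableEquality)
open import Relation.Binary.PropositionalEquality using (_≡_; cong)
open import Relation.Nullary using (¬_; ¬?; Dec; does; no)
open import Relation.Nullary.Decidable using (map′)
open import Level using (0ℓ)
import Data.List.Membership.DecPropositional as DecMembership
import Data.List.Membership.Setoid as SetoidMembership
import Data.List.Relation.Binary.Permutation.Setoid as Permutation

------------------------------------------------------------------------
-- Literals, clauses and multisets of clauses

Var : Set
Var = ℕ

data Literal : Set where
  pos neg : Var → Literal

∼_ : Literal → Literal
∼ pos x = neg x
∼ neg x = pos x

_≟ˡ_ : DecidableEquality Literal
pos x ≟ˡ pos y = map′ (cong pos) (λ { _≡_.refl → _≡_.refl }) (x ≟ y)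
pos x ≟ˡ neg y = no λ ()
neg x ≟ˡ pos y = no λ ()
neg x ≟ˡ neg y = map′ (cong neg) (λ { _≡_.refl → _≡_.refl }) (x ≟ y)

open DecMembership _≟ˡ_ using (_∈?_)

-- A clause is a finite set of literals: lists are always compared by the set
-- equality of `clauseSetoid`. The empty clause is [], the only list
-- representing the empty set. Tautological clauses are allowed.
Clause : Set
Clause = List Literal

clauseSetoid : Setoid 0ℓ 0ℓ
clauseSetoid = [ set ]-Equality Literal

open Setoid clauseSetoid using () renaming (_≈_ to _≈ᶜ_)

-- A multiset of clauses is a list up to _↭_, which permutes entries and
-- identifies equal clauses; _∈ᶜ_ is membership up to equality of clauses.
Clauses : Set
Clauses = List Clause

open Permutation clauseSetoid public using (_↭_)
open SetoidMembership clauseSetoid public using () renaming (_∈_ to _∈ᶜ_)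

multiplicity-⊥ : Clauses → ℕ
multiplicity-⊥ Γ = length (filterᵇ null Γ)

Occurs : Var → Clause → Set
Occurs x C = pos x ∈ C ⊎ neg x ∈ C

------------------------------------------------------------------------
-- Total assignments

Assignment : Set
Assignment = Var → Bool

evalLiteral : Assignment → Literal → Bool
evalLiteral α (pos x) = α x
evalLiteral α (neg x) = not (α x)

infix 4 _⊨ᶜ_ _⊨_

_⊨ᶜ_ : Assignment → Clause → Set
α ⊨ᶜ C = Any (λ l → evalLiteral α l ≡ true) C

_⊨_ : Assignment → Clauses → Set
α ⊨ Γ = All (α ⊨ᶜ_) Γ

_⊨ᶜ?_ : ∀ α C → Dec (α ⊨ᶜ C)
α ⊨ᶜ? C = any? (λ l → evalLiteral α l ≟ᵇ true) C

Satisfiable : Clauses → Set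
Satisfiable Γ = ∃[ α ] α ⊨ Γ

numFalsified : Assignment → Clauses → ℕ
numFalsified α Γ = length (filter (λ C → ¬? (α ⊨ᶜ? C)) Γ)

------------------------------------------------------------------------
-- Substitutions and restriction

data Value : Set where
  const : Bool → Value
  lit   : Literal → Value

negValue : Value → Value
negValue (const v) = const (not v)
negValue (lit l)   = lit (∼ l)

Substitution : Set
Substitution = Var → Value

substLiteral : Substitution → Literal → Value
substLiteral σ (pos x) = σ x
substLiteral σ (neg x) = negValue (σ x)

evalValue : Assignment → Value → Bool
evalValue α (const v) = v
evalValue α (lit l)   = evalLiteral α l

infixr 9 _∘ₛ_

_∘ₛ_ : Assignment → Substitution → Assignment
(α ∘ₛ σ) x = evalValue α (σ x)

-- Disjunction of a value and a clause or the constant 1 (`nothing`), simplified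
-- by 0 ∨ D = D, 1 ∨ D = 1 and l ∨ ¬l ∨ D = 1.
_∨ᵛ_ : Value → Maybe Clause → Maybe Clause
const true  ∨ᵛ D       = nothing
const false ∨ᵛ D       = D
lit l       ∨ᵛ nothing = nothing
lit l       ∨ᵛ just D  = if does ((∼ l) ∈? D) then nothing else just (l ∷ D)

restrictClause : Substitution → Clause → Maybe Clause
restrictClause σ []      = just []
restrictClause σ (l ∷ C) = substLiteral σ l ∨ᵛ restrictClause σ C

infixl 8 _↾_

_↾_ : Clauses → Substitution → Clauses
Γ ↾ σ = mapMaybe (restrictClause σ) Γ

-- The partial assignment falsifying every literal of C. A partial assignment
-- is a substitution whose undefined variables are mapped to themselves.
-- If C is tautological no such assignment exists, and positive literals of C
-- are arbitrarily given precedence.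
¬ᶜ_ : Clause → Substitution
(¬ᶜ C) x = if does (pos x ∈? C) then const false
           else if does (neg x ∈? C) then const true
           else lit (pos x)

_Extends_ : Assignment → Substitution → Set
τ Extends ρ = ∀ x v → ρ x ≡ const v → τ x ≡ v

------------------------------------------------------------------------
-- Unit propagation

-- Unit propagation derives ⊥. Making l true is the partial assignment
-- falsifying the unit clause ¬l.
data UnitRefutable (Γ : Clauses) : Set where
  conflict  : [] ∈ Γ → UnitRefutable Γ
  propagate : ∀ l → [ l ] ∈ᶜ Γ → UnitRefutable (Γ ↾ (¬ᶜ [ ∼ l ])) → UnitRefutable Γ

infix 4 _⊢₁ᶜ_ _⊢₁_

_⊢₁ᶜ_ : Clauses → Clause → Set
Γ ⊢₁ᶜ C = UnitRefutable (Γ ↾ (¬ᶜ C))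

_⊢₁_ : Clauses → Clauses → Set
Γ ⊢₁ Δ = All (Γ ⊢₁ᶜ_) Δ

------------------------------------------------------------------------
-- Cost, the cost-SR rule and derivations, relative to the blocking variables b

module _ {m : ℕ} (b : Fin m → Var) where

  cost : Assignment → ℕ
  cost α = sum (tabulate λ i → if α (b i) then 1 else 0)

  -- c = min { cost α : α total, α ⊨ H }
  IsCost : Clauses → ℕ → Set
  IsCost H c = (∃[ α ] (α ⊨ H × cost α ≡ c)) × (∀ α → α ⊨ H → c ≤ cost α)

  CostSR : Clauses → Clause → Set
  CostSR Γ C = ∃[ σ ] ( Γ ↾ (¬ᶜ C) ⊢₁ (C ∷ Γ) ↾ σ
                      × (∀ τ → τ Extends (¬ᶜ C) → cost (τ ∘ₛ σ) ≤ cost τ) )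

  Config : Set
  Config = Clauses × Clauses

  -- Premises: the current pair is (H , S) and the next one is (H′ , S′).
  data Step : Config → Config → Set where

    resolution : ∀ {H S H′ S′} x C D →
      (pos x ∷ C) ∈ᶜ H → (neg x ∷ D) ∈ᶜ H →
      H′ ↭ (C ++ D) ∷ H → S′ ↭ S →
      Step (H , S) (H′ , S′)

    weakening : ∀ {H S H′ S′} C D →
      C ∈ᶜ H → C ⊆ D →
      H′ ↭ D ∷ H → S′ ↭ S →
      Step (H , S) (H′ , S′)

    costSR : ∀ {H S H′ S′} C →
      CostSR H C →
      H′ ↭ C ∷ H → S′ ↭ S →
      Step (H , S) (H′ , S′)

    copy : ∀ {H S H′ S′} C →
      C ∈ᶜ H →
      H′ ↭ H → S′ ↭ C ∷ S →
      Step (H , S) (H′ , S′)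

    split : ∀ {H S H′ S′} x C R →
      S ↭ C ∷ R →
      H′ ↭ H → S′ ↭ (pos x ∷ C) ∷ (neg x ∷ C) ∷ R →
      Step (H , S) (H′ , S′)

    merge : ∀ {H S H′ S′} x C R →
      S ↭ (pos x ∷ C) ∷ (neg x ∷ C) ∷ R →
      H′ ↭ H → S′ ↭ C ∷ R →
      Step (H , S) (H′ , S′)

  -- Finite sequences of steps between two pairs.
  Derivation : Config → Config → Set
  Derivation = Star Step

hardClauses : ∀ {m} → (Fin m → Clause) → (Fin m → Var) → Clauses
hardClauses C b = tabulate λ i → pos (b i) ∷ C i

softClauses : ∀ {m} → (Fin m → Var) → Clauses
softClauses b = tabulate λ i → [ neg (b i) ]

{-# OPTIONS --safe #-}

-- A cost-SR step need not preserve the models of the hard clauses, but it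
-- replaces any model α by a model of the enlarged set that costs no more: α
-- itself, or α ∘ₛ σ when α falsifies the new clause. So every model of H₀ yields
-- a model β of Hₜ with cost β ≤ cost α. Hard clauses are never deleted, so β is a
-- model of every Hᵢ; hence no step changes the number of soft clauses β
-- falsifies, which is cost β for S₀ and at least the multiplicity of ⊥ for Sₜ.
module Submission where

open import Defs
open import Data.Bool.Base using (Bool; true; false; not; if_then_else_)
open import Data.Bool.Properties using (not-involutive; ¬-not)
open import Data.Fin.Base using (Fin; zero; suc)
open import Data.List.Base using (List; []; _∷_; [_]; _++_; length; map; concat; filter; tabulate; cartesianProductWith)
open import Data.List.Extrema.Nat using (argmin; argmin-all; f[argmin]≤f[xs])
open import Data.List.Membership.Propositional using (_∈_; find; lose)
open import Data.List.Membership.Propositional.Properties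
  using (∈-map⁺; ∈-concat⁺′; ∈-filter⁺; ∈-tabulate⁺; ∈-cartesianProductWith⁺)
open import Data.List.Properties using (filter-accept; filter-reject; tabulate-cong)
open import Data.List.Relation.Binary.Subset.Propositional.Properties using (Any-resp-⊆)
open import Data.List.Relation.Unary.All as All using (All; []; _∷_)
open import Data.List.Relation.Unary.All.Properties using (all-filter)
open import Data.List.Relation.Unary.Any as Any using (Any; here; there)
open import Data.List.Relation.Unary.Any.Properties using (++⁺ˡ; ++⁺ʳ; ∷↔)
open import Data.Maybe.Base using (Maybe; just; nothing)
import Data.Maybe.Relation.Unary.All as Maybe
open import Data.Nat.Base using (ℕ; suc; _≤_; z≤n; s≤s)
open import Data.Nat.ListAction using (sum)
open import Data.Nat.Properties using (_≟_; ≤-refl; ≤-reflexive; ≤-trans; m≤n⇒m≤1+n; module ≤-Reasoning)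
open import Data.Product.Base using (_×_; _,_; ∃-syntax; proj₂)
open import Data.Sum.Base using (_⊎_; inj₁; inj₂)
open import Data.Sum.Function.Propositional using (_⊎-⇔_)
open import Function.Base using (_∘_; case_of_)
open import Function.Bundles using (_⇔_; mk⇔; Equivalence)
open import Function.Definitions using (Injective)
open import Function.Properties.Equivalence using () renaming (trans to ⇔-trans; sym to ⇔-sym)
open import Function.Properties.Inverse using (↔⇒⇔)
open import Relation.Binary.Bundles using (Setoid)
open import Relation.Binary.Construct.Closure.ReflexiveTransitive using (ε; _◅_)
open import Relation.Binary.Definitions using (_Respects_)
open import Relation.Binary.PropositionalEquality
  using (_≡_; _≗_; refl; sym; trans; cong; module ≡-Reasoning)
open import Relation.Nullary using (¬_; ¬?; Dec; yes; no; does; contradiction)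
open import Relation.Nullary.Decidable using (decidable-stable)
import Data.List.Membership.DecPropositional as DecMembership
import Data.List.Relation.Binary.Permutation.Setoid as Permutation
import Data.List.Relation.Binary.Permutation.Setoid.Properties as PermutationProperties

open DecMembership _≟ˡ_ using (_∈?_)
open Setoid clauseSetoid using () renaming (_≈_ to _≈ᶜ_; sym to ≈ᶜ-sym)
open Permutation clauseSetoid using (↭-sym)
open PermutationProperties clauseSetoid using (All-resp-↭; filter⁺; xs↭ys⇒|xs|≡|ys|)
open Equivalence using (to; from)

-- Satisfaction

⊨ᶜ-resp-≈ᶜ : ∀ {α} → (α ⊨ᶜ_) Respects _≈ᶜ_
⊨ᶜ-resp-≈ᶜ C≈D = Any-resp-⊆ (to C≈D)

⊨-∈ᶜ : ∀ {α Γ C} → α ⊨ Γ → C ∈ᶜ Γ → α ⊨ᶜ C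
⊨-∈ᶜ (α⊨D ∷ α⊨Γ) (here C≈D)  = ⊨ᶜ-resp-≈ᶜ (≈ᶜ-sym C≈D) α⊨D
⊨-∈ᶜ (α⊨D ∷ α⊨Γ) (there C∈Γ) = ⊨-∈ᶜ α⊨Γ C∈Γ

⊨-resp-↭ : ∀ {α} → (α ⊨_) Respects _↭_
⊨-resp-↭ = All-resp-↭ ⊨ᶜ-resp-≈ᶜ

resolution-sound : ∀ {α} x C D → α ⊨ᶜ pos x ∷ C → α ⊨ᶜ neg x ∷ D → α ⊨ᶜ C ++ D
resolution-sound x C D (here αx)   (here ¬αx)  = case trans (sym ¬αx) (cong not αx) of λ ()
resolution-sound x C D (here αx)   (there α⊨D) = ++⁺ʳ C α⊨D
resolution-sound x C D (there α⊨C) _           = ++⁺ˡ α⊨C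

evalLiteral-cong : ∀ {α β} → α ≗ β → evalLiteral α ≗ evalLiteral β
evalLiteral-cong α≗β (pos x) = α≗β x
evalLiteral-cong α≗β (neg x) = cong not (α≗β x)

⊨-cong : ∀ {α β} Γ → α ≗ β → α ⊨ Γ → β ⊨ Γ
⊨-cong Γ α≗β = All.map (Any.map (λ {l} → trans (sym (evalLiteral-cong α≗β l))))

evalLiteral-∼ : ∀ α l → evalLiteral α (∼ l) ≡ not (evalLiteral α l)
evalLiteral-∼ α (pos x) = refl
evalLiteral-∼ α (neg x) = sym (not-involutive (α x))

evalLiteral-substLiteral : ∀ α σ l →
  evalLiteral (α ∘ₛ σ) l ≡ evalValue α (substLiteral σ l)
evalLiteral-substLiteral α σ (pos x) = refl
evalLiteral-substLiteral α σ (neg x) with σ x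
... | const v = refl
... | lit l   = sym (evalLiteral-∼ α l)

-- Restriction

-- `nothing` stands for the constant 1, so it holds under every assignment.
_⊨ᵐ_ : Assignment → Maybe Clause → Set
α ⊨ᵐ D = Maybe.All (α ⊨ᶜ_) D

⊨ᵐ-∨ᵛ : ∀ α v D → (evalValue α v ≡ true ⊎ α ⊨ᵐ D) ⇔ α ⊨ᵐ (v ∨ᵛ D)
⊨ᵐ-∨ᵛ α (const true)  D       = mk⇔ (λ _ → Maybe.nothing) (λ _ → inj₁ refl)
⊨ᵐ-∨ᵛ α (const false) D       = mk⇔ (λ { (inj₁ ()) ; (inj₂ d) → d }) inj₂
⊨ᵐ-∨ᵛ α (lit l)       nothing = mk⇔ (λ _ → Maybe.nothing) (λ _ → inj₂ Maybe.nothing)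
⊨ᵐ-∨ᵛ α (lit l)       (just D) with (∼ l) ∈? D
... | no _ = mk⇔
  (λ { (inj₁ e) → Maybe.just (here e) ; (inj₂ (Maybe.just d)) → Maybe.just (there d) })
  (λ { (Maybe.just (here e)) → inj₁ e ; (Maybe.just (there d)) → inj₂ (Maybe.just d) })
-- The simplification to 1 is sound because `α` makes either `l` or `∼ l` true, and `∼ l` is already
-- in `D`.
... | yes ∼l∈D = mk⇔ (λ _ → Maybe.nothing) (λ _ → l∨D)
  where
  l∨D : evalLiteral α l ≡ true ⊎ α ⊨ᵐ just D
  l∨D with evalLiteral α l in eq
  ... | true  = inj₁ refl
  ... | false = inj₂ (Maybe.just (lose ∼l∈D (trans (evalLiteral-∼ α l) (cong not eq))))

-- The substitution lemma: each literal of `D` has the same value under `α ∘ₛ σ` as its image under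
-- `σ` has under `α`, and `∨ᵛ` computes a disjunction. One direction restricts models, the other
-- recovers the model `α ∘ₛ σ` of the original clauses.
⊨ᵐ-restrictClause : ∀ α σ D → α ∘ₛ σ ⊨ᶜ D ⇔ α ⊨ᵐ restrictClause σ D
⊨ᵐ-restrictClause α σ []      = mk⇔ (λ ()) (λ { (Maybe.just ()) })
⊨ᵐ-restrictClause α σ (l ∷ D) =
  ⇔-trans (⇔-sym (↔⇒⇔ (∷↔ _)))
  (⇔-trans (mk⇔ (trans (sym eq)) (trans eq) ⊎-⇔ ⊨ᵐ-restrictClause α σ D)
           (⊨ᵐ-∨ᵛ α (substLiteral σ l) (restrictClause σ D)))
  where eq = evalLiteral-substLiteral α σ l

⊨-↾⁺ : ∀ {α σ} Γ → α ∘ₛ σ ⊨ Γ → α ⊨ Γ ↾ σ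
⊨-↾⁺ []      []        = []
⊨-↾⁺ {α} {σ} (D ∷ Γ) (d ∷ α⊨Γ) with restrictClause σ D | to (⊨ᵐ-restrictClause α σ D) d
... | nothing | _            = ⊨-↾⁺ Γ α⊨Γ
... | just _  | Maybe.just e = e ∷ ⊨-↾⁺ Γ α⊨Γ

⊨-↾⁻ : ∀ {α σ} Γ → α ⊨ Γ ↾ σ → α ∘ₛ σ ⊨ Γ
⊨-↾⁻ [] [] = []
⊨-↾⁻ {α} {σ} (D ∷ Γ) α⊨ with restrictClause σ D | from (⊨ᵐ-restrictClause α σ D)
⊨-↾⁻ (D ∷ Γ) α⊨       | nothing | f = f Maybe.nothing ∷ ⊨-↾⁻ Γ α⊨
⊨-↾⁻ (D ∷ Γ) (e ∷ α⊨) | just _  | f = f (Maybe.just e) ∷ ⊨-↾⁻ Γ α⊨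

-- Unit propagation

-- Wherever `¬ᶜ C` fixes a variable, `α` already has that value, since it falsifies the
-- corresponding literal of `C`; all other variables are sent to themselves.
∘ₛ-¬ᶜ : ∀ {α C} → ¬ α ⊨ᶜ C → α ∘ₛ (¬ᶜ C) ≗ α
∘ₛ-¬ᶜ {C = C} α⊭C x with pos x ∈? C
... | yes x∈C = sym (¬-not (α⊭C ∘ lose x∈C))
... | no  _ with neg x ∈? C
...   | yes ¬x∈C = sym (¬-not (α⊭C ∘ lose ¬x∈C ∘ cong not))
...   | no  _    = refl

Extends-¬ᶜ : ∀ {α C} → ¬ α ⊨ᶜ C → α Extends (¬ᶜ C)
Extends-¬ᶜ {α} α⊭C x v eq = trans (sym (∘ₛ-¬ᶜ α⊭C x)) (cong (evalValue α) eq)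

⊨-↾-¬ᶜ : ∀ {α C} Γ → ¬ α ⊨ᶜ C → α ⊨ Γ → α ⊨ Γ ↾ (¬ᶜ C)
⊨-↾-¬ᶜ Γ α⊭C α⊨Γ = ⊨-↾⁺ Γ (⊨-cong Γ (sym ∘ ∘ₛ-¬ᶜ α⊭C) α⊨Γ)

¬⊨-∼ : ∀ {α l} → evalLiteral α l ≡ true → ¬ α ⊨ᶜ [ ∼ l ]
¬⊨-∼ {α} {l} l≡true (here ∼l≡true) =
  case trans (sym ∼l≡true) (trans (evalLiteral-∼ α l) (cong not l≡true)) of λ ()

-- A model of `Γ` makes every unit clause `[ l ]` true, so it falsifies `[ ∼ l ]` and remains a
-- model after `l` is propagated. It would therefore survive until the conflict and satisfy the
-- empty clause.
UnitRefutable⇒unsat : ∀ {α Γ} → UnitRefutable Γ → ¬ α ⊨ Γ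
UnitRefutable⇒unsat (conflict []∈Γ) α⊨Γ = case All.lookup α⊨Γ []∈Γ of λ ()
UnitRefutable⇒unsat {Γ = Γ} (propagate l l∈Γ r) α⊨Γ with ⊨-∈ᶜ α⊨Γ l∈Γ
... | here l≡true = UnitRefutable⇒unsat r (⊨-↾-¬ᶜ Γ (¬⊨-∼ {l = l} l≡true) α⊨Γ)

⊢₁ᶜ-sound : ∀ {α Γ C} → Γ ⊢₁ᶜ C → α ⊨ Γ → α ⊨ᶜ C
⊢₁ᶜ-sound {α} {Γ} {C} Γ⊢C α⊨Γ = decidable-stable (α ⊨ᶜ? C)
  λ α⊭C → UnitRefutable⇒unsat Γ⊢C (⊨-↾-¬ᶜ Γ α⊭C α⊨Γ)

⊢₁-sound : ∀ {α Γ Δ} → Γ ⊢₁ Δ → α ⊨ Γ → α ⊨ Δ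
⊢₁-sound Γ⊢Δ α⊨Γ = All.map (λ Γ⊢D → ⊢₁ᶜ-sound Γ⊢D α⊨Γ) Γ⊢Δ

-- Falsified soft clauses

module _ {α : Assignment} where

  private
    falsified? = λ C → ¬? (α ⊨ᶜ? C)

  numFalsified-sat : ∀ C Γ → α ⊨ᶜ C → numFalsified α (C ∷ Γ) ≡ numFalsified α Γ
  numFalsified-sat C Γ α⊨C =
    cong length (filter-reject falsified? {xs = Γ} (λ α⊭C → α⊭C α⊨C))

  numFalsified-unsat : ∀ C Γ → ¬ α ⊨ᶜ C → numFalsified α (C ∷ Γ) ≡ suc (numFalsified α Γ)
  numFalsified-unsat C Γ α⊭C =
    cong length (filter-accept falsified? {xs = Γ} α⊭C)

  numFalsified-resp-↭ : ∀ {Γ Δ} → Γ ↭ Δ → numFalsified α Γ ≡ numFalsified α Δ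
  numFalsified-resp-↭ Γ↭Δ = xs↭ys⇒|xs|≡|ys|
    (filter⁺ falsified? (λ C≈D α⊭C → α⊭C ∘ ⊨ᶜ-resp-≈ᶜ (≈ᶜ-sym C≈D)) Γ↭Δ)

  -- If `α` satisfies `C`, it satisfies both extended clauses; otherwise it falsifies exactly one of
  -- them, depending on `α x`. Read in the two directions, this covers both `split` and `merge`.
  numFalsified-split : ∀ x C Γ →
    numFalsified α ((pos x ∷ C) ∷ (neg x ∷ C) ∷ Γ) ≡ numFalsified α (C ∷ Γ)
  numFalsified-split x C Γ = cases (α ⊨ᶜ? C) (α x) refl
    where
    open ≡-Reasoning

    cases : Dec (α ⊨ᶜ C) → ∀ v → α x ≡ v →
      numFalsified α ((pos x ∷ C) ∷ (neg x ∷ C) ∷ Γ) ≡ numFalsified α (C ∷ Γ)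
    cases (yes α⊨C) _ _ = begin
      numFalsified α ((pos x ∷ C) ∷ (neg x ∷ C) ∷ Γ) ≡⟨ numFalsified-sat (pos x ∷ C) ((neg x ∷ C) ∷ Γ) (there α⊨C) ⟩
      numFalsified α ((neg x ∷ C) ∷ Γ)               ≡⟨ numFalsified-sat (neg x ∷ C) Γ (there α⊨C) ⟩
      numFalsified α Γ                               ≡⟨ numFalsified-sat C Γ α⊨C ⟨
      numFalsified α (C ∷ Γ)                         ∎
    cases (no α⊭C) true αx = begin
      numFalsified α ((pos x ∷ C) ∷ (neg x ∷ C) ∷ Γ) ≡⟨ numFalsified-sat (pos x ∷ C) ((neg x ∷ C) ∷ Γ) (here αx) ⟩
      numFalsified α ((neg x ∷ C) ∷ Γ)               ≡⟨ numFalsified-unsat (neg x ∷ C) Γ α⊭¬x∨C ⟩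
      suc (numFalsified α Γ)                         ≡⟨ numFalsified-unsat C Γ α⊭C ⟨
      numFalsified α (C ∷ Γ)                         ∎
      where
      α⊭¬x∨C : ¬ α ⊨ᶜ neg x ∷ C
      α⊭¬x∨C (here ¬αx)  = case trans (sym ¬αx) (cong not αx) of λ ()
      α⊭¬x∨C (there α⊨C) = α⊭C α⊨C
    cases (no α⊭C) false αx = begin
      numFalsified α ((pos x ∷ C) ∷ (neg x ∷ C) ∷ Γ) ≡⟨ numFalsified-unsat (pos x ∷ C) ((neg x ∷ C) ∷ Γ) α⊭x∨C ⟩
      suc (numFalsified α ((neg x ∷ C) ∷ Γ))         ≡⟨ cong suc (numFalsified-sat (neg x ∷ C) Γ (here (cong not αx))) ⟩
      suc (numFalsified α Γ)                         ≡⟨ numFalsified-unsat C Γ α⊭C ⟨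
      numFalsified α (C ∷ Γ)                         ∎
      where
      α⊭x∨C : ¬ α ⊨ᶜ pos x ∷ C
      α⊭x∨C (here αx′)  = case trans (sym αx′) αx of λ ()
      α⊭x∨C (there α⊨C) = α⊭C α⊨C

  multiplicity-⊥≤numFalsified : ∀ Γ → multiplicity-⊥ Γ ≤ numFalsified α Γ
  multiplicity-⊥≤numFalsified []            = z≤n
  multiplicity-⊥≤numFalsified ([] ∷ Γ)      = s≤s (multiplicity-⊥≤numFalsified Γ)
  multiplicity-⊥≤numFalsified ((l ∷ C) ∷ Γ) with does (α ⊨ᶜ? (l ∷ C))
  ... | true  = multiplicity-⊥≤numFalsified Γ
  ... | false = m≤n⇒m≤1+n (multiplicity-⊥≤numFalsified Γ)

  -- The unit clause on `neg (b i)` is falsified exactly when `b i` is true, which is when `b i`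
  -- contributes 1 to the cost.
  numFalsified-softClauses : ∀ {m} (b : Fin m → Var) →
    numFalsified α (softClauses b) ≡ cost b α
  numFalsified-softClauses {0}     b = refl
  numFalsified-softClauses {suc m} b with α (b zero)
  ... | true  = cong suc (numFalsified-softClauses (b ∘ suc))
  ... | false = numFalsified-softClauses (b ∘ suc)

-- Derivations

module _ {m : ℕ} {b : Fin m → Var} where

  CostSR-sound : ∀ {α Γ C} → CostSR b Γ C → α ⊨ Γ →
    ∃[ β ] (β ⊨ C ∷ Γ × cost b β ≤ cost b α)
  CostSR-sound {α} {Γ} {C} (σ , Γ⊢σ , cost-σ) α⊨Γ with α ⊨ᶜ? C
  ... | yes α⊨C = α , α⊨C ∷ α⊨Γ , ≤-refl
  -- Falsifying `C` makes `α` a total extension of `¬ᶜ C`. It then satisfies the restriction of `Γ`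
  -- by `¬ᶜ C`, hence by unit propagation that of `C ∷ Γ` by `σ`; condition (2), taken at `α`,
  -- bounds the cost.
  ... | no  α⊭C = α ∘ₛ σ
                , ⊨-↾⁻ (C ∷ Γ) (⊢₁-sound Γ⊢σ (⊨-↾-¬ᶜ Γ α⊭C α⊨Γ))
                , cost-σ α (Extends-¬ᶜ α⊭C)

  Step-model : ∀ {H S H′ S′ α} → Step b (H , S) (H′ , S′) → α ⊨ H →
    ∃[ β ] (β ⊨ H′ × cost b β ≤ cost b α)
  Step-model {α = α} (resolution x C D x∨C ¬x∨D H′↭ _) α⊨H =
    α , ⊨-resp-↭ (↭-sym H′↭) (resolution-sound x C D (⊨-∈ᶜ α⊨H x∨C) (⊨-∈ᶜ α⊨H ¬x∨D) ∷ α⊨H) , ≤-refl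
  Step-model {α = α} (weakening C D C∈H C⊆D H′↭ _) α⊨H =
    α , ⊨-resp-↭ (↭-sym H′↭) (Any-resp-⊆ C⊆D (⊨-∈ᶜ α⊨H C∈H) ∷ α⊨H) , ≤-refl
  Step-model (costSR C C-costSR H′↭ _) α⊨H with CostSR-sound C-costSR α⊨H
  ... | β , β⊨C∷H , β≤α = β , ⊨-resp-↭ (↭-sym H′↭) β⊨C∷H , β≤α
  Step-model {α = α} (copy _ _ H′↭ _)      α⊨H = α , ⊨-resp-↭ (↭-sym H′↭) α⊨H , ≤-refl
  Step-model {α = α} (split _ _ _ _ H′↭ _) α⊨H = α , ⊨-resp-↭ (↭-sym H′↭) α⊨H , ≤-refl
  Step-model {α = α} (merge _ _ _ _ H′↭ _) α⊨H = α , ⊨-resp-↭ (↭-sym H′↭) α⊨H , ≤-refl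

  Step-hard : ∀ {H S H′ S′ α} → Step b (H , S) (H′ , S′) → α ⊨ H′ → α ⊨ H
  Step-hard (resolution _ _ _ _ _ H′↭ _) α⊨H′ = All.tail (⊨-resp-↭ H′↭ α⊨H′)
  Step-hard (weakening _ _ _ _ H′↭ _)    α⊨H′ = All.tail (⊨-resp-↭ H′↭ α⊨H′)
  Step-hard (costSR _ _ H′↭ _)           α⊨H′ = All.tail (⊨-resp-↭ H′↭ α⊨H′)
  Step-hard (copy _ _ H′↭ _)             α⊨H′ = ⊨-resp-↭ H′↭ α⊨H′
  Step-hard (split _ _ _ _ H′↭ _)        α⊨H′ = ⊨-resp-↭ H′↭ α⊨H′
  Step-hard (merge _ _ _ _ H′↭ _)        α⊨H′ = ⊨-resp-↭ H′↭ α⊨H′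

  Step-soft : ∀ {H S H′ S′ α} → Step b (H , S) (H′ , S′) → α ⊨ H →
    numFalsified α S′ ≡ numFalsified α S
  Step-soft (resolution _ _ _ _ _ _ S′↭) α⊨H = numFalsified-resp-↭ S′↭
  Step-soft (weakening _ _ _ _ _ S′↭)    α⊨H = numFalsified-resp-↭ S′↭
  Step-soft (costSR _ _ _ S′↭)           α⊨H = numFalsified-resp-↭ S′↭
  -- The hard clause `C` is true under `α`, so its copy adds nothing to the count.
  Step-soft {S = S} (copy C C∈H _ S′↭)   α⊨H =
    trans (numFalsified-resp-↭ S′↭) (numFalsified-sat C S (⊨-∈ᶜ α⊨H C∈H))
  Step-soft (split x C R S↭ _ S′↭)       α⊨H =
    trans (numFalsified-resp-↭ S′↭)
    (trans (numFalsified-split x C R) (sym (numFalsified-resp-↭ S↭)))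
  Step-soft (merge x C R S↭ _ S′↭)       α⊨H =
    trans (numFalsified-resp-↭ S′↭)
    (trans (sym (numFalsified-split x C R)) (sym (numFalsified-resp-↭ S↭)))

  Derivation-model : ∀ {H S H′ S′ α} → Derivation b (H , S) (H′ , S′) → α ⊨ H →
    ∃[ β ] (β ⊨ H′ × cost b β ≤ cost b α)
  Derivation-model ε       α⊨H = _ , α⊨H , ≤-refl
  Derivation-model (s ◅ d) α⊨H with Step-model s α⊨H
  ... | β , β⊨ , β≤α with Derivation-model d β⊨
  ...   | γ , γ⊨ , γ≤β = γ , γ⊨ , ≤-trans γ≤β β≤α

  -- The assignment is known to be a model only at the end of the derivation, so satisfaction is
  -- carried backwards alongside the count, to be available at each `copy`.
  Derivation-soft : ∀ {H S H′ S′ α} → Derivation b (H , S) (H′ , S′) → α ⊨ H′ →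
    α ⊨ H × numFalsified α S′ ≡ numFalsified α S
  Derivation-soft ε       α⊨H′ = α⊨H′ , refl
  Derivation-soft (s ◅ d) α⊨H′ with Derivation-soft d α⊨H′
  ... | α⊨ , eq = Step-hard s α⊨ , trans eq (Step-soft s (Step-hard s α⊨))

  multiplicity-⊥≤cost : ∀ {H Hₜ Sₜ} → Derivation b (H , softClauses b) (Hₜ , Sₜ) →
    ∀ α → α ⊨ H → multiplicity-⊥ Sₜ ≤ cost b α
  multiplicity-⊥≤cost {Sₜ = Sₜ} d α α⊨H with Derivation-model d α⊨H
  -- The count is made for `β`: a cost-SR step may have added a hard clause that `α` falsifies, and
  -- a copy of it would change the count for `α`.
  ... | β , β⊨Hₜ , β≤α = begin
    multiplicity-⊥ Sₜ              ≤⟨ multiplicity-⊥≤numFalsified Sₜ ⟩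
    numFalsified β Sₜ              ≡⟨ proj₂ (Derivation-soft d β⊨Hₜ) ⟩
    numFalsified β (softClauses b) ≡⟨ numFalsified-softClauses b ⟩
    cost b β                       ≤⟨ β≤α ⟩
    cost b α                       ∎
    where open ≤-Reasoning

-- Existence of the minimal cost

var : Literal → Var
var (pos x) = x
var (neg x) = x

vars : Clauses → List Var
vars Γ = map var (concat Γ)

AgreeOn : List Var → Assignment → Assignment → Set
AgreeOn xs α β = ∀ {x} → x ∈ xs → α x ≡ β x

evalLiteral-agree : ∀ {α β} l → α (var l) ≡ β (var l) → evalLiteral α l ≡ evalLiteral β l
evalLiteral-agree (pos x) eq = eq
evalLiteral-agree (neg x) eq = cong not eq

⊨-agree : ∀ {α β Γ} → AgreeOn (vars Γ) α β → α ⊨ Γ → β ⊨ Γ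
⊨-agree {α} {β} agree α⊨Γ = All.tabulate λ C∈Γ →
  let l , l∈C , l≡true = find (All.lookup α⊨Γ C∈Γ)
  in lose l∈C (trans (sym (evalLiteral-agree l (agree (∈-map⁺ var (∈-concat⁺′ l∈C C∈Γ))))) l≡true)

cost-agree : ∀ {m} {b : Fin m → Var} {α β xs} → (∀ i → b i ∈ xs) →
  AgreeOn xs α β → cost b α ≡ cost b β
cost-agree b∈xs agree =
  cong sum (tabulate-cong λ i → cong (λ v → if v then 1 else 0) (agree (b∈xs i)))

_[_↦_] : Assignment → Var → Bool → Assignment
(α [ x ↦ v ]) y with x ≟ y
... | yes _ = v
... | no  _ = α y

-- All assignments to the listed variables, extended by `false` elsewhere.
assignments : List Var → List Assignment
assignments []       = [ (λ _ → false) ]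
assignments (x ∷ xs) =
  cartesianProductWith (λ v α → α [ x ↦ v ]) (true ∷ false ∷ []) (assignments xs)

-- This reduces minimisation over infinitely many total assignments to a finite search: satisfaction
-- and cost depend only on finitely many variables.
assignments-complete : ∀ xs α → ∃[ β ] (β ∈ assignments xs × AgreeOn xs α β)
assignments-complete []       α = _ , here refl , λ ()
assignments-complete (x ∷ xs) α with assignments-complete xs α
... | β , β∈ , agree = β [ x ↦ α x ] , ∈-cartesianProductWith⁺ (λ v γ → γ [ x ↦ v ]) (bool∈ (α x)) β∈ , agree′
  where
  bool∈ : ∀ v → v ∈ true ∷ false ∷ []
  bool∈ true  = here refl
  bool∈ false = there (here refl)

  agree′ : AgreeOn (x ∷ xs) α (β [ x ↦ α x ])
  agree′ {y} y∈ with x ≟ y | y∈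
  ... | yes refl | _         = refl
  ... | no x≢y   | here y≡x  = contradiction (sym y≡x) x≢y
  ... | no _     | there y∈′ = agree y∈′

-- The assumption on `b` ensures that assignments agreeing on `vars Γ` have equal cost, so each
-- model can be replaced by its representative among the candidates.
IsCost-exists : ∀ {m} {b : Fin m → Var} {Γ} → (∀ i → b i ∈ vars Γ) →
  Satisfiable Γ → ∃[ c ] IsCost b Γ c
IsCost-exists {b = b} {Γ} b∈Γ (α₀ , α₀⊨Γ) =
  cost b α* , (α* , argmin-all (cost b) α₀⊨Γ (all-filter ⊨Γ? candidates) , refl) , minimal
  where
  ⊨Γ? = λ α → All.all? (α ⊨ᶜ?_) Γ

  candidates = assignments (vars Γ)

  α* : Assignment
  -- The given model `α₀` is the default of `argmin`, so `α*` is a model whether or not the default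
  -- is selected.
  α* = argmin (cost b) α₀ (filter ⊨Γ? candidates)

  minimal : ∀ α → α ⊨ Γ → cost b α* ≤ cost b α
  minimal α α⊨Γ with assignments-complete (vars Γ) α
  ... | β , β∈ , agree = begin
    cost b α* ≤⟨ All.lookup (f[argmin]≤f[xs] α₀ _) (∈-filter⁺ ⊨Γ? β∈ (⊨-agree agree α⊨Γ)) ⟩
    cost b β  ≡⟨ cost-agree b∈Γ agree ⟨
    cost b α  ∎
    where open ≤-Reasoning

blocking∈vars : ∀ {m} (C : Fin m → Clause) (b : Fin m → Var) i → b i ∈ vars (hardClauses C b)
blocking∈vars C b i = ∈-map⁺ var (∈-concat⁺′ (here refl) (∈-tabulate⁺ i))

theorem7p4 : ∀ {m : ℕ} (C : Fin m → Clause) (b : Fin m → Var) →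
    Injective _≡_ _≡_ b →
    (∀ i j → ¬ Occurs (b i) (C j)) →
    Satisfiable (hardClauses C b) →
    ∀ (Hₜ Sₜ : Clauses) (k : ℕ) →
    Derivation b (hardClauses C b , softClauses b) (Hₜ , Sₜ) →
    multiplicity-⊥ Sₜ ≡ k →
    (∀ α → α ⊨ hardClauses C b → k ≤ numFalsified α (softClauses b))
    × (∃[ c ] (IsCost b (hardClauses C b) c × k ≤ c))
theorem7p4 C b _ _ sat Hₜ Sₜ _ d refl with IsCost-exists {b = b} (blocking∈vars C b) sat
-- The minimum `c` is attained at the model `α`, so the bound that holds for every model yields
-- `k ≤ c` when applied to `α`.
... | c , isCost@((α , α⊨H₀ , refl) , _) =
    (λ β β⊨H₀ → ≤-trans (multiplicity-⊥≤cost d β β⊨H₀)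
                        (≤-reflexive (sym (numFalsified-softClauses b))))
  , c , isCost , multiplicity-⊥≤cost d α α⊨H₀
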